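{- Let $\mathcal{A},\mathcal{B}$ be alphabets, let $x \in \mathcal{A}^{\mathbb{Z}}$ be a bi-infinite word which is eventually weak or neutral, or which is eventually strong or neutral, and let $\sigma : \mathcal{A}^* \to \mathcal{B}^*$ be a non-erasing morphism. Then there exists $C \in \mathbb{Z}$ such that $$p_{\sigma(x)}(n) \leq C + p_x(n)$$ for all $n \geq 0$.
   Context: An alphabet is a finite set of letters (of size at least 2). A morphism $\sigma : \mathcal{A}^* \to \mathcal{B}^*$ is a monoid homomorphism; it is non-erasing if $\sigma(a) \neq \varepsilon$ (the empty word) for all $a \in \mathcal{A}$, and then it extends naturally to bi-infinite words. For $x \in \mathcal{A}^{\mathbb{Z}}$, $\mathcal{L}(x)$ is the set of finite factors of $x$, $\mathcal{L}_n(x)$ and $\mathcal{L}_{\geq n}(x)$ are the sets of factors of length exactly $n$ and at least $n$, and the factor complexity is $p_x(n) = \# \mathcal{L}_n(x)$. For $w \in \mathcal{L}(x)$ define $E^-_x(w) = \{a \mid aw \in \mathcal{L}(x)\}$, $E^+_x(w) = \{b \mid wb \in \mathcal{L}(x)\}$, $E_x(w) = \{(a,b) \mid awb \in \mathcal{L}(x)\}$, and $m_x(w) = \# E_x(w) - \# E^-_x(w) - \# E^+_x(w) + 1$. The word $w$ is neutral (resp., weak, strong) if $m_x(w) = 0$ (resp., $m_x(w)<0$, $m_x(w)>0$). The bi-infinite word $x$ is eventually weak (resp., strong) or neutral if there exists $N \geq 0$ such that every $w \in \mathcal{L}_{\geq N}(x)$ is weak (resp., strong) or neutral, i.e. $m_x(w)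 \le 0$ (resp., $m_x(w) \geq 0$). -}

module Defs where

open import Algebra.Morphism.Structures using (module MonoidMorphisms)
open import Axiom.ExcludedMiddle using (ExcludedMiddle)
open import Data.Empty using (⊥-elim)
open import Data.Fin.Base using (Fin; fromℕ<)
open import Data.Integer.Base as ℤ using (ℤ; +_; -[1+_])
open import Data.List.Base using (List; []; _∷_; [_]; _++_; length; map; filter; lookup; reverse; allFin; cartesianProduct; cartesianProductWith; ++-[]-rawMonoid)
open import Data.List.Properties using (length-++; length-reverse)
open import Data.Nat.Base using (ℕ; zero; suc; _+_; _≤_; _<_; z≤n; s≤s)
open import Data.Nat.Properties using (+-mono-≤; ≤-reflexive; ≤-trans)
open import Data.Product.Base using (_×_; _,_; ∃-syntax)
open import Data.Sum.Base using (_⊎_)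
open import Function.Bundles using (_↔_; Inverse)
open import Level using (0ℓ)
open import Relation.Binary.PropositionalEquality using (_≡_; _≢_; refl; sym; cong; subst)

record Alphabet : Set₁ where
  field
    Letter      : Set
    size        : ℕ
    2≤size      : 2 ≤ size
    enumeration : Fin size ↔ Letter

  letters : List Letter
  letters = map (Inverse.to enumeration) (allFin size)

open Alphabet public

Word : Alphabet → Set
Word A = List (Letter A)

BiInfiniteWord : Set → Set
BiInfiniteWord X = ℤ → X

wordsOfLength : (A : Alphabet) → ℕ → List (Word A)
wordsOfLength A zero    = [ [] ]
wordsOfLength A (suc n) = cartesianProductWith _∷_ (letters A) (wordsOfLength A n)

-- The cardinality of the set { x in xs | P x }, where xs lists every element
-- of a finite set exactly once.  Membership in the language of an arbitrary
-- bi-infinite word is undecidable, so counting relies on excluded middle.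
card : ExcludedMiddle 0ℓ → {X : Set} → List X → (X → Set) → ℕ
card em xs P = length (filter (λ x → em {P x}) xs)

-- x i, x (i + 1), …, x (i + n - 1)
block : {X : Set} → BiInfiniteWord X → ℤ → ℕ → List X
block x i zero    = []
block x i (suc n) = x i ∷ block x (ℤ.suc i) n

module _ {X : Set} (x : BiInfiniteWord X) where

  𝓛 : List X → Set
  𝓛 w = ∃[ i ] ∃[ n ] block x i n ≡ w

  𝓛[_] : ℕ → List X → Set
  𝓛[ n ] w = 𝓛 w × length w ≡ n

  𝓛≥[_] : ℕ → List X → Set
  𝓛≥[ n ] w = 𝓛 w × n ≤ length w

  E⁻ : List X → X → Set
  E⁻ w a = 𝓛 (a ∷ w)

  E⁺ : List X → X → Set
  E⁺ w b = 𝓛 (w ++ [ b ])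

  E : List X → X × X → Set
  E w (a , b) = 𝓛 (a ∷ w ++ [ b ])

module _ (em : ExcludedMiddle 0ℓ) (A : Alphabet) (x : BiInfiniteWord (Letter A)) where

  complexity : ℕ → ℕ
  complexity n = card em (wordsOfLength A n) (𝓛[_] x n)

  multiplicity : Word A → ℤ
  multiplicity w = + card em (cartesianProduct (letters A) (letters A)) (E x w)
                   ℤ.- + card em (letters A) (E⁻ x w)
                   ℤ.- + card em (letters A) (E⁺ x w)
                   ℤ.+ + 1

  Neutral Weak Strong : Word A → Set
  Neutral w = multiplicity w ≡ + 0
  Weak    w = multiplicity w ℤ.< + 0
  Strong  w = multiplicity w ℤ.> + 0

  EventuallyWeakOrNeutral : Set
  EventuallyWeakOrNeutral = ∃[ N ] (∀ w → 𝓛≥[_] x N w → Weak w ⊎ Neutral w)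

  EventuallyStrongOrNeutral : Set
  EventuallyStrongOrNeutral = ∃[ N ] (∀ w → 𝓛≥[_] x N w → Strong w ⊎ Neutral w)

record Morphism (A B : Alphabet) : Set where
  open MonoidMorphisms (++-[]-rawMonoid (Letter A)) (++-[]-rawMonoid (Letter B))
  field
    ⟦_⟧                  : Word A → Word B
    isMonoidHomomorphism : IsMonoidHomomorphism ⟦_⟧

  open IsMonoidHomomorphism isMonoidHomomorphism public using (homo)

open Morphism public using (⟦_⟧)

NonErasing : {A B : Alphabet} → Morphism A B → Set
NonErasing {A} σ = (a : Letter A) → ⟦ σ ⟧ [ a ] ≢ []

length-block : {X : Set} (x : BiInfiniteWord X) (i : ℤ) (n : ℕ) → length (block x i n) ≡ n
length-block x i zero    = refl
length-block x i (suc n) = cong suc (length-block x (ℤ.suc i) n)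

module _ {A B : Alphabet} (σ : Morphism A B) (ne : NonErasing σ) where

  length≤length-image : (w : Word A) → length w ≤ length (⟦ σ ⟧ w)
  length≤length-image []      = z≤n
  length≤length-image (a ∷ w) =
    ≤-trans (+-mono-≤ (nonempty (⟦ σ ⟧ [ a ]) (ne a)) (length≤length-image w))
            (≤-reflexive (sym eq))
    where
    nonempty : (v : Word B) → v ≢ [] → 1 ≤ length v
    nonempty []      v≢[] = ⊥-elim (v≢[] refl)
    nonempty (_ ∷ _) _    = s≤s z≤n

    eq : length (⟦ σ ⟧ (a ∷ w)) ≡ length (⟦ σ ⟧ [ a ]) + length (⟦ σ ⟧ w)
    eq rewrite Morphism.homo σ [ a ] w = length-++ (⟦ σ ⟧ [ a ])

  image-long : (x : BiInfiniteWord (Letter A)) (i : ℤ) (n : ℕ) → n < length (⟦ σ ⟧ (block x i (suc n)))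
  image-long x i n =
    subst (_≤ length (⟦ σ ⟧ (block x i (suc n)))) (length-block x i (suc n))
          (length≤length-image (block x i (suc n)))

  -- σ(x) = ⋯ σ(x₋₂) σ(x₋₁) . σ(x₀) σ(x₁) ⋯, the dot preceding position 0.
  -- As σ is non-erasing, position n ≥ 0 lies within σ(x₀ ⋯ xₙ), and position
  -- -(n + 1) lies within σ(x₋₍ₙ₊₁₎ ⋯ x₋₁), where it is read from the right end.
  image : BiInfiniteWord (Letter A) → BiInfiniteWord (Letter B)
  image x (+ n) = lookup (⟦ σ ⟧ (block x (+ 0) (suc n))) (fromℕ< (image-long x (+ 0) n))
  image x -[1+ n ] =
    lookup (reverse (⟦ σ ⟧ (block x -[1+ n ] (suc n))))
           (fromℕ< (subst (n <_) (sym (length-reverse (⟦ σ ⟧ (block x -[1+ n ] (suc n))))) (image-long x -[1+ n ] n)))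

{-# OPTIONS --safe #-}
module Submission where

open import Defs
open import Algebra.Morphism.Structures using (module MonoidMorphisms)
open import Axiom.ExcludedMiddle using (ExcludedMiddle)
open import Data.Bool.Base using (if_then_else_)
open import Data.Fin.Base using (fromℕ<)
open import Data.Integer.Base as ℤ using (ℤ; -[1+_]; +≤+)
import Data.Integer.Properties as ℤ
open import Data.Integer.Solver using (module +-*-Solver)
open import Data.List.Base using (List; []; _∷_; [_]; _++_; length; map; take; lookup; reverse; downFrom; cartesianProduct; cartesianProductWith)
open import Data.List.Membership.Propositional using (_∈_)
open import Data.List.Membership.Propositional.Properties using (∈-map⁺; ∈-allFin; ∈-cartesianProductWith⁺; ∈-cartesianProductWith⁻)
open import Data.List.Properties using (length-++; length-reverse; ++-assoc; ++-identityʳ; ++-conicalʳ; reverse-++; unfold-reverse; reverse-involutive; ∷-injective)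
open import Data.List.Relation.Unary.All as All using ([])
open import Data.List.Relation.Unary.AllPairs.Core using ([]; _∷_)
open import Data.List.Relation.Unary.Any using (here; there)
open import Data.List.Relation.Unary.Unique.Propositional using (Unique)
import Data.List.Relation.Unary.Unique.Propositional.Properties as Unique
open import Data.Nat.Base using (ℕ; zero; suc; _+_; _*_; _∸_; _≤_; _<_; z≤n; s≤s)
open import Data.Nat.Properties
open import Data.Nat.Induction using (<-rec)
open import Data.Product.Base using (_×_; _,_; proj₁; proj₂; ∃-syntax)
open import Data.Sum.Base using (_⊎_; inj₁; inj₂)
open import Function.Base using (_∘_)
open import Function.Bundles using (Injection; Inverse)
open import Function.Properties.Inverse using (Inverse⇒Injection)
open import Level using (0ℓ)
open import Relation.Binary.PropositionalEquality using (_≡_; _≢_; refl; sym; trans; cong; cong₂; subst; module ≡-Reasoning)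
open import Relation.Nullary.Decidable.Core using (yes; no; does)
open import Relation.Nullary.Negation.Core using (¬_; contradiction)
open import Algebra.Properties.CommutativeSemigroup +-commutativeSemigroup using (interchange; x∙yz≈y∙xz)

-- Let r(w) = #E⁺(w) - 1 be the excess of a factor w of x.  Then
-- m(w) = Σ_a r(aw) - r(w), so m governs how excess flows through the tree in
-- which the children of w are its left extensions aw, and p_x(n) is 1 plus the
-- total excess of the levels s < n.
--
-- A factor of length n of σ(x) starts with a nonempty suffix of some σ(a) and is
-- then read off along the tree of right extensions.  Counting the leaves of that
-- tree through its branchings bounds p_σ(x)(n) by a constant plus, for each
-- s < n, the excess on the cut { av : |σ(v)| < s ≤ |σ(av)| } of the first tree.
-- Since σ is non-erasing, this cut lies above level s.  If long words satisfy
-- m ≥ 0, its excess is therefore at most that of level s, for all large s.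
--
-- If instead long words satisfy m ≤ 0, the level excesses eventually decrease and
-- so become constant, which forces m = 0 on all long words.

-- Finite sums over lists

∑ : {X : Set} → List X → (X → ℕ) → ℕ
∑ []       f = 0
∑ (x ∷ xs) f = f x + ∑ xs f

infix 5 ∑
syntax ∑ xs (λ x → e) = ∑[ x ∈ xs ] e

module _ {X : Set} where

  ∑-mono-∈ : (xs : List X) {f g : X → ℕ} → (∀ {x} → x ∈ xs → f x ≤ g x) → ∑ xs f ≤ ∑ xs g
  ∑-mono-∈ []       f≤g = z≤n
  ∑-mono-∈ (x ∷ xs) f≤g = +-mono-≤ (f≤g (here refl)) (∑-mono-∈ xs (f≤g ∘ there))

  ∑-mono : (xs : List X) {f g : X → ℕ} → (∀ x → f x ≤ g x) → ∑ xs f ≤ ∑ xs g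
  ∑-mono xs f≤g = ∑-mono-∈ xs (λ {x} _ → f≤g x)

  ∑-cong : (xs : List X) {f g : X → ℕ} → (∀ x → f x ≡ g x) → ∑ xs f ≡ ∑ xs g
  ∑-cong []       f≡g = refl
  ∑-cong (x ∷ xs) f≡g = cong₂ _+_ (f≡g x) (∑-cong xs f≡g)

  ∑-+ : (xs : List X) (f g : X → ℕ) → ∑[ x ∈ xs ] (f x + g x) ≡ ∑ xs f + ∑ xs g
  ∑-+ []       f g = refl
  ∑-+ (x ∷ xs) f g rewrite ∑-+ xs f g = interchange (f x) (g x) (∑ xs f) (∑ xs g)

  ∑-*ʳ : (xs : List X) (f : X → ℕ) (k : ℕ) → ∑[ x ∈ xs ] (f x * k) ≡ ∑ xs f * k
  ∑-*ʳ []       f k = refl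
  ∑-*ʳ (x ∷ xs) f k rewrite ∑-*ʳ xs f k = sym (*-distribʳ-+ k (f x) (∑ xs f))

  ∑-0 : (xs : List X) {f : X → ℕ} → (∀ {x} → x ∈ xs → f x ≡ 0) → ∑ xs f ≡ 0
  ∑-0 []       f≡0 = refl
  ∑-0 (x ∷ xs) f≡0 = cong₂ _+_ (f≡0 (here refl)) (∑-0 xs (f≡0 ∘ there))

  ∑-++ : (xs ys : List X) (f : X → ℕ) → ∑ (xs ++ ys) f ≡ ∑ xs f + ∑ ys f
  ∑-++ []       ys f = refl
  ∑-++ (x ∷ xs) ys f rewrite ∑-++ xs ys f = sym (+-assoc (f x) (∑ xs f) (∑ ys f))

  term≤∑ : {xs : List X} (f : X → ℕ) {x : X} → x ∈ xs → f x ≤ ∑ xs f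
  term≤∑ f (here refl)  = m≤m+n _ _
  term≤∑ f (there x∈xs) = ≤-trans (term≤∑ f x∈xs) (m≤n+m _ _)

  -- A strict drop at one entry cannot be compensated, since no entry goes the other way. This turns
  -- an equality of level totals into one for each word.
  ∑-antisym : (xs : List X) {f g : X → ℕ} → (∀ {x} → x ∈ xs → g x ≤ f x) → ∑ xs f ≤ ∑ xs g →
              ∀ {x} → x ∈ xs → f x ≤ g x
  ∑-antisym (x ∷ xs) {f} {g} g≤f ∑f≤∑g (here refl) =
    +-cancelʳ-≤ (∑ xs g) (f x) (g x)
      (≤-trans (+-monoʳ-≤ (f x) (∑-mono-∈ xs (g≤f ∘ there))) ∑f≤∑g)
  ∑-antisym (x ∷ xs) {f} {g} g≤f ∑f≤∑g (there y∈xs) =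
    ∑-antisym xs (g≤f ∘ there)
      (+-cancelˡ-≤ (f x) (∑ xs f) (∑ xs g) (≤-trans ∑f≤∑g (+-monoˡ-≤ (∑ xs g) (g≤f (here refl))))) y∈xs

∑-swap : {X Y : Set} (xs : List X) (ys : List Y) (f : X → Y → ℕ) →
         ∑[ x ∈ xs ] ∑[ y ∈ ys ] f x y ≡ ∑[ y ∈ ys ] ∑[ x ∈ xs ] f x y
∑-swap []       ys f = sym (∑-0 ys (λ _ → refl))
∑-swap (x ∷ xs) ys f = trans (cong (∑ ys (f x) +_) (∑-swap xs ys f)) (sym (∑-+ ys (f x) _))

∑-map : {X Y : Set} (h : X → Y) (xs : List X) (f : Y → ℕ) → ∑ (map h xs) f ≡ ∑ xs (f ∘ h)
∑-map h []       f = refl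
∑-map h (x ∷ xs) f = cong (f (h x) +_) (∑-map h xs f)

∑-cartesianProductWith : {X Y Z : Set} (h : X → Y → Z) (xs : List X) (ys : List Y) (f : Z → ℕ) →
                         ∑ (cartesianProductWith h xs ys) f ≡ ∑[ x ∈ xs ] ∑[ y ∈ ys ] f (h x y)
∑-cartesianProductWith h []       ys f = refl
∑-cartesianProductWith h (x ∷ xs) ys f =
  trans (∑-++ (map (h x) ys) _ f)
        (cong₂ _+_ (∑-map (h x) ys f) (∑-cartesianProductWith h xs ys f))

∑-downFrom-mono : (f : ℕ → ℕ) {m n : ℕ} → m ≤ n → ∑ (downFrom m) f ≤ ∑ (downFrom n) f
∑-downFrom-mono f {n = zero}  z≤n = z≤n
∑-downFrom-mono f {n = suc n} m≤1+n with m≤n⇒m<n∨m≡n m≤1+n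
... | inj₁ (s≤s m≤n) = ≤-trans (∑-downFrom-mono f m≤n) (m≤n+m _ _)
... | inj₂ refl      = ≤-refl

-- The finitely many terms below `s₀`, where nothing is known, are paid for once by a constant that
-- does not depend on `n`.
∑-downFrom-eventually-≤ : (f g : ℕ → ℕ) (s₀ : ℕ) → (∀ {s} → s₀ ≤ s → f s ≤ g s) →
                          ∀ n → ∑ (downFrom n) f ≤ ∑ (downFrom s₀) f + ∑ (downFrom n) g
∑-downFrom-eventually-≤ f g s₀ f≤g zero = z≤n
∑-downFrom-eventually-≤ f g s₀ f≤g (suc n) with ≤-<-connex s₀ n
... | inj₂ n<s₀ = ≤-trans (∑-downFrom-mono f n<s₀) (m≤m+n _ _)
... | inj₁ s₀≤n = begin
  f n + ∑ (downFrom n) f                         ≤⟨ +-mono-≤ (f≤g s₀≤n) (∑-downFrom-eventually-≤ f g s₀ f≤g n) ⟩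
  g n + (∑ (downFrom s₀) f + ∑ (downFrom n) g)   ≡⟨ x∙yz≈y∙xz (g n) (∑ (downFrom s₀) f) (∑ (downFrom n) g) ⟩
  ∑ (downFrom s₀) f + (g n + ∑ (downFrom n) g)   ∎
  where open ≤-Reasoning

-- Words of given and of bounded length

module _ (A : Alphabet) where

  ∈-letters : (a : Letter A) → a ∈ letters A
  ∈-letters a = subst (_∈ letters A) (Inverse.strictlyInverseˡ (enumeration A) a)
                      (∈-map⁺ (Inverse.to (enumeration A)) (∈-allFin (Inverse.from (enumeration A) a)))

  letters-unique : Unique (letters A)
  letters-unique = Unique.map⁺ (Injection.injective (Inverse⇒Injection (enumeration A))) (Unique.allFin⁺ (size A))

  words-unique : ∀ n → Unique (wordsOfLength A n)
  words-unique zero    = [] ∷ []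
  words-unique (suc n) = Unique.cartesianProductWith⁺ _∷_ ∷-injective letters-unique (words-unique n)

  ∈-words : (w : Word A) → w ∈ wordsOfLength A (length w)
  ∈-words []      = here refl
  ∈-words (a ∷ w) = ∈-cartesianProductWith⁺ _∷_ (∈-letters a) (∈-words w)

  length-∈-words : ∀ n {w} → w ∈ wordsOfLength A n → length w ≡ n
  length-∈-words zero    (here refl) = refl
  length-∈-words (suc n) w∈ with ∈-cartesianProductWith⁻ _∷_ (letters A) (wordsOfLength A n) w∈
  ... | _ , _ , _ , v∈ , refl = cong suc (length-∈-words n v∈)

  -- Listed as a tree, the root followed by the subtrees under each first letter: the shape of the
  -- induction in `∑-Reach-≤`. Grouping by length is recovered in `∑-wordsBelow-suc`.
  wordsBelow : ℕ → List (Word A)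
  wordsBelow zero    = []
  wordsBelow (suc n) = [] ∷ cartesianProductWith _∷_ (letters A) (wordsBelow n)

  ∑-words-∷ : ∀ n (f : Word A → ℕ) →
              ∑ (wordsOfLength A (suc n)) f ≡ ∑[ w ∈ wordsOfLength A n ] ∑[ a ∈ letters A ] f (a ∷ w)
  ∑-words-∷ n f = trans (∑-cartesianProductWith _∷_ (letters A) (wordsOfLength A n) f)
                        (∑-swap (letters A) (wordsOfLength A n) _)

  -- Both groupings of a level are needed: by last letter to count right extensions, by first letter
  -- to pass from a word to its children.
  ∑-words-∷ʳ : ∀ n (f : Word A → ℕ) →
               ∑ (wordsOfLength A (suc n)) f ≡ ∑[ w ∈ wordsOfLength A n ] ∑[ b ∈ letters A ] f (w ++ [ b ])
  ∑-words-∷ʳ zero    f = ∑-words-∷ zero f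
  ∑-words-∷ʳ (suc n) f = begin
    ∑ (wordsOfLength A (suc (suc n))) f
      ≡⟨ ∑-cartesianProductWith _∷_ (letters A) (wordsOfLength A (suc n)) f ⟩
    ∑[ a ∈ letters A ] ∑[ w ∈ wordsOfLength A (suc n) ] f (a ∷ w)
      ≡⟨ ∑-cong (letters A) (λ a → ∑-words-∷ʳ n (f ∘ (a ∷_))) ⟩
    ∑[ a ∈ letters A ] ∑[ w ∈ wordsOfLength A n ] ∑[ b ∈ letters A ] f (a ∷ w ++ [ b ])
      ≡⟨ ∑-cartesianProductWith _∷_ (letters A) (wordsOfLength A n) _ ⟨
    ∑[ w ∈ wordsOfLength A (suc n) ] ∑[ b ∈ letters A ] f (w ++ [ b ]) ∎
    where open ≡-Reasoning

  ∑-wordsBelow-suc : ∀ n (f : Word A → ℕ) →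
                     ∑ (wordsBelow (suc n)) f ≡ ∑ (wordsBelow n) f + ∑ (wordsOfLength A n) f
  ∑-wordsBelow-suc zero    f =
    cong (f [] +_) (trans (∑-cartesianProductWith _∷_ (letters A) [] f) (∑-0 (letters A) (λ _ → refl)))
  ∑-wordsBelow-suc (suc n) f = begin
    f [] + ∑ (cartesianProductWith _∷_ (letters A) (wordsBelow (suc n))) f
      ≡⟨ cong (f [] +_) (∑-cartesianProductWith _∷_ (letters A) (wordsBelow (suc n)) f) ⟩
    f [] + (∑[ a ∈ letters A ] ∑[ w ∈ wordsBelow (suc n) ] f (a ∷ w))
      ≡⟨ cong (f [] +_) (∑-cong (letters A) (λ a → ∑-wordsBelow-suc n (f ∘ (a ∷_)))) ⟩
    f [] + (∑[ a ∈ letters A ] (∑ (wordsBelow n) (f ∘ (a ∷_)) + ∑ (wordsOfLength A n) (f ∘ (a ∷_))))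
      ≡⟨ cong (f [] +_) (∑-+ (letters A) _ _) ⟩
    f [] + ((∑[ a ∈ letters A ] ∑ (wordsBelow n) (f ∘ (a ∷_))) + (∑[ a ∈ letters A ] ∑ (wordsOfLength A n) (f ∘ (a ∷_))))
      ≡⟨ +-assoc (f []) _ _ ⟨
    (f [] + (∑[ a ∈ letters A ] ∑ (wordsBelow n) (f ∘ (a ∷_)))) + (∑[ a ∈ letters A ] ∑ (wordsOfLength A n) (f ∘ (a ∷_)))
      ≡⟨ cong₂ (λ p q → f [] + p + q) (∑-cartesianProductWith _∷_ (letters A) (wordsBelow n) f)
                                      (∑-cartesianProductWith _∷_ (letters A) (wordsOfLength A n) f) ⟨
    ∑ (wordsBelow (suc n)) f + ∑ (wordsOfLength A (suc n)) f ∎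
    where open ≡-Reasoning

  ∑-wordsBelow-vanishing : {f : Word A → ℕ} {s : ℕ} → (∀ {w} → s ≤ length w → f w ≡ 0) →
                           ∀ n → ∑ (wordsBelow n) f ≤ ∑ (wordsBelow s) f
  ∑-wordsBelow-vanishing {f} {s} f≡0 zero    = z≤n
  ∑-wordsBelow-vanishing {f} {s} f≡0 (suc n) with ≤-<-connex s n
  ... | inj₁ s≤n rewrite ∑-wordsBelow-suc n f
                       | ∑-0 (wordsOfLength A n) {f} (λ w∈ → f≡0 (≤-trans s≤n (≤-reflexive (sym (length-∈-words n w∈)))))
                       | +-identityʳ (∑ (wordsBelow n) f) = ∑-wordsBelow-vanishing f≡0 n
  ... | inj₂ n<s = wordsBelow-mono n<s
    where
    wordsBelow-mono : ∀ {m n} → m ≤ n → ∑ (wordsBelow m) f ≤ ∑ (wordsBelow n) f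
    wordsBelow-mono {n = zero} z≤n = z≤n
    wordsBelow-mono {n = suc n} m≤1+n with m≤n⇒m<n∨m≡n m≤1+n
    ... | inj₁ (s≤s m≤n) = ≤-trans (wordsBelow-mono m≤n) (≤-trans (m≤m+n _ _) (≤-reflexive (sym (∑-wordsBelow-suc n f))))
    ... | inj₂ refl      = ≤-refl

-- Factors of a bi-infinite word

module _ {X : Set} (x : BiInfiniteWord X) where

  block-++ : ∀ i m n → block x i (m + n) ≡ block x i m ++ block x (i ℤ.+ ℤ.+ m) n
  block-++ i zero    n = cong (λ j → block x j n) (sym (ℤ.+-identityʳ i))
  block-++ i (suc m) n = cong (x i ∷_) (trans (block-++ (ℤ.suc i) m n) (cong (λ j → block x (ℤ.suc i) m ++ block x j n) shift))
    where
    shift : ℤ.suc i ℤ.+ ℤ.+ m ≡ i ℤ.+ ℤ.+ suc m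
    shift = trans (cong (ℤ._+ ℤ.+ m) (ℤ.+-comm (ℤ.+ 1) i)) (ℤ.+-assoc i (ℤ.+ 1) (ℤ.+ m))

  𝓛-prefix : ∀ v w → 𝓛 x (v ++ w) → 𝓛 x v
  𝓛-prefix v w (i , n , eq) = i , length v , go v i n eq
    where
    go : ∀ v i n → block x i n ≡ v ++ w → block x i (length v) ≡ v
    go []      i n       eq = refl
    go (a ∷ v) i (suc n) eq = cong₂ _∷_ (proj₁ (∷-injective eq)) (go v (ℤ.suc i) n (proj₂ (∷-injective eq)))

  𝓛-suffix : ∀ v {w} → 𝓛 x (v ++ w) → 𝓛 x w
  𝓛-suffix []      w∈              = w∈
  𝓛-suffix (a ∷ v) (i , suc n , eq) = 𝓛-suffix v (ℤ.suc i , n , proj₂ (∷-injective eq))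

  𝓛-extend : ∀ {w} → 𝓛 x w → ∃[ b ] 𝓛 x (w ++ [ b ])
  𝓛-extend (i , n , refl) = x (i ℤ.+ ℤ.+ n) , i , n + 1 , block-++ i n 1

-- Splitting concatenations

nonemptySuffixes : {X : Set} → List X → List (List X)
nonemptySuffixes []       = []
nonemptySuffixes (x ∷ xs) = (x ∷ xs) ∷ nonemptySuffixes xs

take-++ : {X : Set} (u : List X) {q p r : List X} → u ++ q ≡ p ++ r → length u ≤ length p → u ≡ take (length u) p
take-++ []      eq _ = refl
take-++ (_ ∷ u) {p = _ ∷ p} eq (s≤s u≤p) = cong₂ _∷_ (proj₁ (∷-injective eq)) (take-++ u (proj₂ (∷-injective eq)) u≤p)

-- Compare where `p` ends with where `s` ends. A tie goes to the second case, which keeps `d`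
-- nonempty in the first.
++-split : {X : Set} (p s : List X) {u t : List X} → p ++ u ≡ s ++ t →
           (∃[ d ] (d ∈ nonemptySuffixes s × u ≡ d ++ t)) ⊎ (∃[ p′ ] (p′ ++ u ≡ t))
++-split p       []      eq = inj₂ (p , eq)
++-split []      (c ∷ s) eq = inj₁ (c ∷ s , here refl , eq)
++-split (_ ∷ p) (c ∷ s) eq with ++-split p s (proj₂ (∷-injective eq))
... | inj₁ (d , d∈ , eq′) = inj₁ (d , there d∈ , eq′)
... | inj₂ tail           = inj₂ tail

-- Links the `lookup` in the definition of `image` to prefixes: index `n` holds the letter just
-- after a prefix of length `n`.
++-lookup : {X : Set} (p : List X) {q w : List X} {n : ℕ} (n<w : n < length w) → length p ≡ n → w ≡ p ++ q →
            ∃[ q′ ] (w ≡ p ++ lookup w (fromℕ< n<w) ∷ q′)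
++-lookup []      {w = a ∷ w} (s≤s n<w) refl eq   = w , refl
++-lookup (a ∷ p) (s≤s n<w) refl refl = let q′ , eq = ++-lookup p n<w refl refl in q′ , cong (a ∷_) eq

-- Factors of the image and their preimages

module _ {A B : Alphabet} (σ : Morphism A B) where

  ⟦⟧-[] : ⟦ σ ⟧ [] ≡ []
  ⟦⟧-[] = MonoidMorphisms.IsMonoidHomomorphism.ε-homo (Morphism.isMonoidHomomorphism σ)

  imageLength : Word A → ℕ
  imageLength w = length (⟦ σ ⟧ w)

  imageLength-∷ : ∀ a w → imageLength (a ∷ w) ≡ imageLength [ a ] + imageLength w
  imageLength-∷ a w = trans (cong length (Morphism.homo σ [ a ] w)) (length-++ (⟦ σ ⟧ [ a ]))

  imageLength-≤ : ∀ w → imageLength w ≤ length w * ∑ (letters A) (λ a → imageLength [ a ])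
  imageLength-≤ []      = ≤-reflexive (cong length ⟦⟧-[])
  imageLength-≤ (a ∷ w) = ≤-trans (≤-reflexive (imageLength-∷ a w))
    (+-mono-≤ (term≤∑ (λ a → imageLength [ a ]) (∈-letters A a)) (imageLength-≤ w))

  -- Strip the images of the letters of `w` from `p` until `p` ends inside some σ(a); `d` is what
  -- remains of σ(a). As `u` is nonempty, the letters of `w` cannot run out first.
  locate : ∀ w p {u} → u ≢ [] → p ++ u ≡ ⟦ σ ⟧ w →
           ∃[ v ] ∃[ a ] ∃[ z ] ∃[ d ] (w ≡ v ++ a ∷ z × d ∈ nonemptySuffixes (⟦ σ ⟧ [ a ]) × u ≡ d ++ ⟦ σ ⟧ z)
  locate []      p u≢[] eq = contradiction (++-conicalʳ p _ (trans eq ⟦⟧-[])) u≢[]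
  locate (a ∷ w) p u≢[] eq with ++-split p (⟦ σ ⟧ [ a ]) (trans eq (Morphism.homo σ [ a ] w))
  ... | inj₁ (d , d∈ , eq′) = [] , a , w , d , refl , d∈ , eq′
  ... | inj₂ (p′ , eq′) with locate w p′ u≢[] eq′
  ...   | v , b , z , d , w≡ , rest = a ∷ v , b , z , d , cong (a ∷_) w≡ , rest

  module _ (ne : NonErasing σ) (x : BiInfiniteWord (Letter A)) where

    private
      y : BiInfiniteWord (Letter B)
      y = image σ ne x

    ⟦⟧-block-++ : ∀ i m n → ⟦ σ ⟧ (block x i (m + n)) ≡ ⟦ σ ⟧ (block x i m) ++ ⟦ σ ⟧ (block x (i ℤ.+ ℤ.+ m) n)
    ⟦⟧-block-++ i m n = trans (cong ⟦ σ ⟧ (block-++ x i m n)) (Morphism.homo σ (block x i m) _)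

    -- Each position is defined through a different finite image, but these images are prefixes of
    -- one another, so the letters read from them fit together.
    image-right : ∀ n → ∃[ q ] (⟦ σ ⟧ (block x (ℤ.+ 0) n) ≡ block y (ℤ.+ 0) n ++ q)
    image-right zero    = _ , refl
    image-right (suc n) with image-right n
    ... | q , eq with ++-lookup (block y (ℤ.+ 0) n) (image-long σ ne x (ℤ.+ 0) n) (length-block y (ℤ.+ 0) n)
                        (trans (subst (λ m → ⟦ σ ⟧ (block x (ℤ.+ 0) m) ≡ ⟦ σ ⟧ (block x (ℤ.+ 0) n) ++ ⟦ σ ⟧ (block x (ℤ.+ n) 1)) (+-comm n 1) (⟦⟧-block-++ (ℤ.+ 0) n 1))
                        (trans (cong (_++ ⟦ σ ⟧ (block x (ℤ.+ n) 1)) eq) (++-assoc (block y (ℤ.+ 0) n) q _)))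
    ... | q′ , eq′ = q′ , trans eq′ (trans (sym (++-assoc (block y (ℤ.+ 0) n) [ y (ℤ.+ n) ] q′))
                            (cong (_++ q′) (subst (λ m → block y (ℤ.+ 0) n ++ [ y (ℤ.+ n) ] ≡ block y (ℤ.+ 0) m) (+-comm n 1) (sym (block-++ y (ℤ.+ 0) n 1)))))

    suc-[1+] : ∀ n → ℤ.suc -[1+ n ] ≡ ℤ.- (ℤ.+ n)
    suc-[1+] zero    = refl
    suc-[1+] (suc n) = refl

    -- The mirror image of `image-right`: negative positions are read from the right end, and
    -- reversal turns the nested suffixes into prefixes, so that `++-lookup` applies.
    image-left : ∀ n → ∃[ p ] (⟦ σ ⟧ (block x (ℤ.- (ℤ.+ n)) n) ≡ p ++ block y (ℤ.- (ℤ.+ n)) n)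
    image-left zero    = [] , ⟦⟧-[]
    image-left (suc n) with image-left n
    ... | p , eq with ++-lookup (reverse (block y (ℤ.- (ℤ.+ n)) n))
                        (subst (n <_) (sym (length-reverse (⟦ σ ⟧ (block x -[1+ n ] (suc n))))) (image-long σ ne x -[1+ n ] n))
                        (trans (length-reverse (block y (ℤ.- (ℤ.+ n)) n)) (length-block y (ℤ.- (ℤ.+ n)) n))
                        reversed
      where
      open ≡-Reasoning
      reversed : reverse (⟦ σ ⟧ (block x -[1+ n ] (suc n))) ≡ reverse (block y (ℤ.- (ℤ.+ n)) n) ++ reverse (⟦ σ ⟧ [ x -[1+ n ] ] ++ p)
      reversed = begin
        reverse (⟦ σ ⟧ (x -[1+ n ] ∷ block x (ℤ.suc -[1+ n ]) n))
          ≡⟨ cong (λ i → reverse (⟦ σ ⟧ (x -[1+ n ] ∷ block x i n))) (suc-[1+] n) ⟩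
        reverse (⟦ σ ⟧ (x -[1+ n ] ∷ block x (ℤ.- (ℤ.+ n)) n))
          ≡⟨ cong reverse (trans (Morphism.homo σ [ x -[1+ n ] ] _) (cong (⟦ σ ⟧ [ x -[1+ n ] ] ++_) eq)) ⟩
        reverse (⟦ σ ⟧ [ x -[1+ n ] ] ++ p ++ block y (ℤ.- (ℤ.+ n)) n)
          ≡⟨ cong reverse (++-assoc (⟦ σ ⟧ [ x -[1+ n ] ]) p _) ⟨
        reverse ((⟦ σ ⟧ [ x -[1+ n ] ] ++ p) ++ block y (ℤ.- (ℤ.+ n)) n)
          ≡⟨ reverse-++ (⟦ σ ⟧ [ x -[1+ n ] ] ++ p) _ ⟩
        reverse (block y (ℤ.- (ℤ.+ n)) n) ++ reverse (⟦ σ ⟧ [ x -[1+ n ] ] ++ p) ∎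
    ... | q′ , eq′ = reverse q′ , (begin
        ⟦ σ ⟧ (block x -[1+ n ] (suc n))
          ≡⟨ reverse-involutive _ ⟨
        reverse (reverse (⟦ σ ⟧ (block x -[1+ n ] (suc n))))
          ≡⟨ cong reverse eq′ ⟩
        reverse (reverse (block y (ℤ.- (ℤ.+ n)) n) ++ y -[1+ n ] ∷ q′)
          ≡⟨ reverse-++ (reverse (block y (ℤ.- (ℤ.+ n)) n)) _ ⟩
        reverse (y -[1+ n ] ∷ q′) ++ reverse (reverse (block y (ℤ.- (ℤ.+ n)) n))
          ≡⟨ cong₂ _++_ (unfold-reverse (y -[1+ n ]) q′) (reverse-involutive _) ⟩
        (reverse q′ ++ [ y -[1+ n ] ]) ++ block y (ℤ.- (ℤ.+ n)) n
          ≡⟨ ++-assoc (reverse q′) _ _ ⟩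
        reverse q′ ++ y -[1+ n ] ∷ block y (ℤ.- (ℤ.+ n)) n
          ≡⟨ cong (λ i → reverse q′ ++ y -[1+ n ] ∷ block y i n) (suc-[1+] n) ⟨
        reverse q′ ++ block y -[1+ n ] (suc n) ∎)
      where open ≡-Reasoning

    image-factor : ∀ i n → ∃[ w ] ∃[ p ] ∃[ q ] (𝓛 x w × p ++ block y i n ++ q ≡ ⟦ σ ⟧ w)
    image-factor (ℤ.+ m) n with image-right (m + n)
    ... | q , eq = _ , block y (ℤ.+ 0) m , q , (ℤ.+ 0 , m + n , refl) ,
      sym (trans eq (trans (cong (_++ q) (block-++ y (ℤ.+ 0) m n)) (++-assoc (block y (ℤ.+ 0) m) _ q)))
    -- The window is enlarged to run from `i` to the origin and then `n` positions further, so that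
    -- it is assembled from the two one-sided descriptions; the surplus goes into the right
    -- remainder.
    image-factor i@(-[1+ m ]) n with image-left (suc m) | image-right n
    ... | p , eqˡ | q , eqʳ = _ , p , block y (i ℤ.+ ℤ.+ n) (suc m) ++ q , (i , suc m + n , refl) , sym (begin
      ⟦ σ ⟧ (block x i (suc m + n))
        ≡⟨ ⟦⟧-block-++ i (suc m) n ⟩
      ⟦ σ ⟧ (block x i (suc m)) ++ ⟦ σ ⟧ (block x (i ℤ.+ ℤ.+ suc m) n)
        ≡⟨ cong (λ j → ⟦ σ ⟧ (block x i (suc m)) ++ ⟦ σ ⟧ (block x j n)) origin ⟩
      ⟦ σ ⟧ (block x i (suc m)) ++ ⟦ σ ⟧ (block x (ℤ.+ 0) n)
        ≡⟨ cong₂ _++_ eqˡ eqʳ ⟩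
      (p ++ block y i (suc m)) ++ block y (ℤ.+ 0) n ++ q
        ≡⟨ trans (++-assoc p _ _) (cong (p ++_) (sym (++-assoc (block y i (suc m)) _ q))) ⟩
      p ++ (block y i (suc m) ++ block y (ℤ.+ 0) n) ++ q
        ≡⟨ cong (λ j → p ++ (block y i (suc m) ++ block y j n) ++ q) origin ⟨
      p ++ (block y i (suc m) ++ block y (i ℤ.+ ℤ.+ suc m) n) ++ q
        ≡⟨ cong (λ u → p ++ u ++ q) (block-++ y i (suc m) n) ⟨
      p ++ block y i (suc m + n) ++ q
        ≡⟨ cong (λ k → p ++ block y i k ++ q) (+-comm (suc m) n) ⟩
      p ++ block y i (n + suc m) ++ q
        ≡⟨ cong (λ u → p ++ u ++ q) (block-++ y i n (suc m)) ⟩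
      p ++ (block y i n ++ block y (i ℤ.+ ℤ.+ n) (suc m)) ++ q
        ≡⟨ cong (p ++_) (++-assoc (block y i n) _ q) ⟩
      p ++ block y i n ++ block y (i ℤ.+ ℤ.+ n) (suc m) ++ q ∎)
      where
      open ≡-Reasoning
      origin : i ℤ.+ ℤ.+ suc m ≡ ℤ.+ 0
      origin = ℤ.+-inverseˡ (ℤ.+ suc m)

  -- `u` is a prefix of p σ(z) for some `z` in `P`. Here `p` is the image text produced so far and
  -- `P` the set of possible continuations, so reading a letter `b` appends σ(b) to `p` and replaces
  -- `P` by `P ∘ (b ∷_)`.
  Reach : Word B → (Word A → Set) → Word B → Set
  Reach p P u = ∃[ z ] ∃[ q ] (P z × u ++ q ≡ p ++ ⟦ σ ⟧ z)

  image-reach : (ne : NonErasing σ) (x : BiInfiniteWord (Letter A)) → ∀ {u} → 𝓛 (image σ ne x) u →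
                ∃[ a ] ∃[ d ] (d ∈ nonemptySuffixes (⟦ σ ⟧ [ a ]) × Reach d (𝓛 x ∘ (a ∷_)) u)
  -- One extra letter makes the located word nonempty even for `n = 0`; it is moved to the remainder
  -- afterwards.
  image-reach ne x (i , n , refl) with image-factor ne x i (n + 1)
  ... | w , p , q , w∈ , eq with locate w p nonempty eq
    where
    nonempty : block (image σ ne x) i (n + 1) ++ q ≢ []
    nonempty rewrite +-comm n 1 = λ ()
  ... | v , a , z , d , refl , d∈ , eq′ = a , d , d∈ , z , _ , 𝓛-suffix x v w∈ ,
    trans (sym (trans (cong (_++ q) (block-++ (image σ ne x) i n 1)) (++-assoc (block (image σ ne x) i n) _ q))) eq′

-- Cardinalities as sums of indicators

module _ (em : ExcludedMiddle 0ℓ) where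

  𝟙 : Set → ℕ
  𝟙 P = if does (em {P}) then 1 else 0

  𝟙-true : {P : Set} → P → 𝟙 P ≡ 1
  𝟙-true {P} p with em {P}
  ... | yes _ = refl
  ... | no ¬p = contradiction p ¬p

  𝟙-false : {P : Set} → ¬ P → 𝟙 P ≡ 0
  𝟙-false {P} ¬p with em {P}
  ... | yes p = contradiction p ¬p
  ... | no _  = refl

  𝟙-≤ : {P : Set} {k : ℕ} → (P → 1 ≤ k) → 𝟙 P ≤ k
  𝟙-≤ {P} 1≤k with em {P}
  ... | yes p = 1≤k p
  ... | no _  = z≤n

  𝟙-mono : {P Q : Set} → (P → Q) → 𝟙 P ≤ 𝟙 Q
  𝟙-mono P⇒Q = 𝟙-≤ (λ p → ≤-reflexive (sym (𝟙-true (P⇒Q p))))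

  card≡∑𝟙 : {X : Set} (xs : List X) (P : X → Set) → card em xs P ≡ ∑[ x ∈ xs ] 𝟙 (P x)
  card≡∑𝟙 []       P = refl
  card≡∑𝟙 (x ∷ xs) P with em {P x}
  ... | yes _ = cong suc (card≡∑𝟙 xs P)
  ... | no _  = card≡∑𝟙 xs P

  ∑𝟙≤1 : {X : Set} {xs : List X} {P : X → Set} → Unique xs →
         (∀ {x y} → x ∈ xs → y ∈ xs → P x → P y → x ≡ y) → ∑[ x ∈ xs ] 𝟙 (P x) ≤ 1
  ∑𝟙≤1 []             _    = z≤n
  ∑𝟙≤1 {xs = x ∷ xs} {P} (x∉xs ∷ uniq) P-prop with em {P x}
  ... | yes px = ≤-reflexive (cong suc (∑-0 xs (λ y∈ → 𝟙-false (λ py → All.lookup x∉xs y∈ (P-prop (here refl) (there y∈) px py)))))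
  ... | no _   = ∑𝟙≤1 uniq (λ x∈ y∈ → P-prop (there x∈) (there y∈))

  -- Excess, multiplicity and complexity

  module _ (A : Alphabet) where

    degree : (Word A → Set) → Word A → ℕ
    degree P w = ∑[ b ∈ letters A ] 𝟙 (P (w ++ [ b ]))

    -- Truncated: 0 when w has no extension in P.
    excess : (Word A → Set) → Word A → ℕ
    excess P w = degree P w ∸ 1

    PrefixClosed : (Word A → Set) → Set
    PrefixClosed P = ∀ v w → P (v ++ w) → P v

    module _ (x : BiInfiniteWord (Letter A)) where

      degree-∉ : ∀ {w} → ¬ 𝓛 x w → degree (𝓛 x) w ≡ 0
      degree-∉ {w} w∉ = ∑-0 (letters A) (λ {b} _ → 𝟙-false (λ wb∈ → w∉ (𝓛-prefix x w [ b ] wb∈)))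

      excess-∉ : ∀ {w} → ¬ 𝓛 x w → excess (𝓛 x) w ≡ 0
      excess-∉ w∉ = cong (_∸ 1) (degree-∉ w∉)

      -- A factor of a bi-infinite word always extends to the right, so the truncation in `excess`
      -- loses nothing on it; on a non-factor all three terms vanish.
      degree≡𝟙+excess : ∀ w → degree (𝓛 x) w ≡ 𝟙 (𝓛 x w) + excess (𝓛 x) w
      degree≡𝟙+excess w with em {𝓛 x w}
      ... | no w∉  = trans (degree-∉ w∉) (sym (excess-∉ w∉))
      ... | yes w∈ = sym (m+[n∸m]≡n (let b , wb∈ = 𝓛-extend x w∈ in
                       ≤-trans (≤-reflexive (sym (𝟙-true wb∈))) (term≤∑ (λ b → 𝟙 (𝓛 x (w ++ [ b ]))) (∈-letters A b))))

      childExcess : Word A → ℕ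
      childExcess w = ∑[ a ∈ letters A ] excess (𝓛 x) (a ∷ w)

      -- The first difference p_x(n + 1) - p_x(n) of the complexity.
      levelExcess : ℕ → ℕ
      levelExcess n = ∑ (wordsOfLength A n) (excess (𝓛 x))

      -- Grouping the pairs of `E` by their left letter gives #E(w) = #E⁻(w) + Σ_a r(aw), while
      -- #E⁺(w) = 1 + r(w); the rest cancels.
      multiplicity≡ : ∀ {w} → 𝓛 x w → multiplicity em A x w ≡ ℤ.+ childExcess w ℤ.- ℤ.+ excess (𝓛 x) w
      multiplicity≡ {w} w∈ = begin
        ℤ.+ card em (cartesianProduct (letters A) (letters A)) (E x w) ℤ.- ℤ.+ card em (letters A) (E⁻ x w) ℤ.- ℤ.+ card em (letters A) (E⁺ x w) ℤ.+ ℤ.+ 1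
          ≡⟨ cong₂ (λ e e⁺ → ℤ.+ e ℤ.- ℤ.+ card em (letters A) (E⁻ x w) ℤ.- ℤ.+ e⁺ ℤ.+ ℤ.+ 1) E≡ E⁺≡ ⟩
        ℤ.+ (card em (letters A) (E⁻ x w) + childExcess w) ℤ.- ℤ.+ card em (letters A) (E⁻ x w) ℤ.- ℤ.+ (1 + excess (𝓛 x) w) ℤ.+ ℤ.+ 1
          ≡⟨ solve 3 (λ e⁻ c r → (e⁻ :+ c) :- e⁻ :- (con (ℤ.+ 1) :+ r) :+ con (ℤ.+ 1) := c :- r) refl
               (ℤ.+ card em (letters A) (E⁻ x w)) (ℤ.+ childExcess w) (ℤ.+ excess (𝓛 x) w) ⟩
        ℤ.+ childExcess w ℤ.- ℤ.+ excess (𝓛 x) w ∎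
        where
        open ≡-Reasoning
        open +-*-Solver

        E≡ : card em (cartesianProduct (letters A) (letters A)) (E x w) ≡ card em (letters A) (E⁻ x w) + childExcess w
        E≡ = begin
          card em (cartesianProduct (letters A) (letters A)) (E x w)  ≡⟨ card≡∑𝟙 (cartesianProduct (letters A) (letters A)) (E x w) ⟩
          ∑ (cartesianProduct (letters A) (letters A)) (𝟙 ∘ E x w)    ≡⟨ ∑-cartesianProductWith _,_ (letters A) (letters A) _ ⟩
          ∑[ a ∈ letters A ] degree (𝓛 x) (a ∷ w)                     ≡⟨ ∑-cong (letters A) (λ a → degree≡𝟙+excess (a ∷ w)) ⟩
          ∑[ a ∈ letters A ] (𝟙 (E⁻ x w a) + excess (𝓛 x) (a ∷ w))    ≡⟨ ∑-+ (letters A) _ _ ⟩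
          ∑ (letters A) (𝟙 ∘ E⁻ x w) + childExcess w                  ≡⟨ cong (_+ childExcess w) (card≡∑𝟙 (letters A) (E⁻ x w)) ⟨
          card em (letters A) (E⁻ x w) + childExcess w                ∎

        E⁺≡ : card em (letters A) (E⁺ x w) ≡ 1 + excess (𝓛 x) w
        E⁺≡ = trans (card≡∑𝟙 (letters A) (E⁺ x w))
                    (trans (degree≡𝟙+excess w) (cong (_+ excess (𝓛 x) w) (𝟙-true w∈)))

      -- The sum telescopes; the inequality discards p_x(0).
      ∑levelExcess≤complexity : ∀ n → ∑ (downFrom n) levelExcess ≤ complexity em A x n
      ∑levelExcess≤complexity zero    = z≤n
      ∑levelExcess≤complexity (suc n) = begin
        levelExcess n + ∑ (downFrom n) levelExcess
          ≤⟨ +-monoʳ-≤ (levelExcess n) (∑levelExcess≤complexity n) ⟩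
        levelExcess n + complexity em A x n
          ≡⟨ cong (levelExcess n +_) (card≡∑𝟙 (wordsOfLength A n) (𝓛[_] x n)) ⟩
        levelExcess n + ∑ (wordsOfLength A n) (𝟙 ∘ 𝓛[_] x n)
          ≤⟨ +-monoʳ-≤ (levelExcess n) (∑-mono (wordsOfLength A n) (λ _ → 𝟙-mono proj₁)) ⟩
        levelExcess n + ∑ (wordsOfLength A n) (𝟙 ∘ 𝓛 x)
          ≡⟨ trans (+-comm (levelExcess n) _) (sym (∑-+ (wordsOfLength A n) _ _)) ⟩
        ∑[ w ∈ wordsOfLength A n ] (𝟙 (𝓛 x w) + excess (𝓛 x) w)
          ≡⟨ ∑-cong (wordsOfLength A n) degree≡𝟙+excess ⟨
        ∑[ w ∈ wordsOfLength A n ] degree (𝓛 x) w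
          ≡⟨ ∑-words-∷ʳ A n (𝟙 ∘ 𝓛 x) ⟨
        ∑ (wordsOfLength A (suc n)) (𝟙 ∘ 𝓛 x)
          ≤⟨ ∑-mono-∈ (wordsOfLength A (suc n)) (λ w∈ → 𝟙-mono (_, length-∈-words A (suc n) w∈)) ⟩
        ∑ (wordsOfLength A (suc n)) (𝟙 ∘ 𝓛[_] x (suc n))
          ≡⟨ card≡∑𝟙 (wordsOfLength A (suc n)) (𝓛[_] x (suc n)) ⟨
        complexity em A x (suc n) ∎
        where open ≤-Reasoning

      -- On factors this says m(w) ≥ 0. Non-factors are included at no cost, their excess being 0,
      -- so that whole levels can be summed.
      EventuallyExpanding : Set
      EventuallyExpanding = ∃[ N ] (∀ w → N ≤ length w → excess (𝓛 x) w ≤ childExcess w)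

      strong⇒expanding : EventuallyStrongOrNeutral em A x → EventuallyExpanding
      strong⇒expanding (N , strong) = N , go
        where
        go : ∀ w → N ≤ length w → excess (𝓛 x) w ≤ childExcess w
        go w N≤ with em {𝓛 x w}
        ... | no w∉  = ≤-trans (≤-reflexive (excess-∉ w∉)) z≤n
        ... | yes w∈ = ℤ.drop‿+≤+ (ℤ.0≤i-j⇒j≤i (subst (ℤ.+ 0 ℤ.≤_) (multiplicity≡ w∈) (nonneg (strong w (w∈ , N≤)))))
          where
          nonneg : Strong em A x w ⊎ Neutral em A x w → ℤ.+ 0 ℤ.≤ multiplicity em A x w
          nonneg (inj₁ m>0) = ℤ.<⇒≤ m>0
          nonneg (inj₂ m≡0) = ℤ.≤-reflexive (sym m≡0)

      -- Each long word has at least the excess of its children together, yet from level `M` on the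
      -- totals no longer drop. Hence equality holds word by word, by `∑-antisym`.
      weak⇒expanding : EventuallyWeakOrNeutral em A x → EventuallyExpanding
      weak⇒expanding (N , weak) = let M , N≤M , const = stabilise N ≤-refl in
        M , λ w M≤ → ∑-antisym (wordsOfLength A (length w))
          (λ {v} v∈ → contracting v (subst (N ≤_) (sym (length-∈-words A (length w) v∈)) (≤-trans N≤M M≤)))
          (≤-trans (const (length w) M≤)
            (≤-reflexive (∑-words-∷ A (length w) (excess (𝓛 x)))))
          (∈-words A w)
        where
        contracting : ∀ w → N ≤ length w → childExcess w ≤ excess (𝓛 x) w
        contracting w N≤ with em {𝓛 x w}
        ... | no w∉  = ≤-trans (≤-reflexive (∑-0 (letters A) (λ {a} _ → excess-∉ (λ aw∈ → w∉ (𝓛-suffix x [ a ] aw∈))))) z≤n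
        ... | yes w∈ = ℤ.drop‿+≤+ (ℤ.i-j≤0⇒i≤j (subst (ℤ._≤ ℤ.+ 0) (multiplicity≡ w∈) (nonpos (weak w (w∈ , N≤)))))
          where
          nonpos : Weak em A x w ⊎ Neutral em A x w → multiplicity em A x w ℤ.≤ ℤ.+ 0
          nonpos (inj₁ m<0) = ℤ.<⇒≤ m<0
          nonpos (inj₂ m≡0) = ℤ.≤-reflexive m≡0

        Stable : ℕ → Set
        Stable M = ∀ n → M ≤ n → levelExcess n ≤ levelExcess (suc n)

        step : ∀ n → N ≤ n → levelExcess (suc n) ≤ levelExcess n
        step n N≤n = ≤-trans (≤-reflexive (∑-words-∷ A n (excess (𝓛 x))))
          (∑-mono-∈ (wordsOfLength A n) (λ {w} w∈ → contracting w (subst (N ≤_) (sym (length-∈-words A n w∈)) N≤n)))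

        decreasing : ∀ {m n} → N ≤ m → m ≤ n → levelExcess n ≤ levelExcess m
        decreasing {n = zero} N≤m z≤n = ≤-refl
        decreasing {n = suc n} N≤m m≤1+n with m≤n⇒m<n∨m≡n m≤1+n
        ... | inj₁ (s≤s m≤n) = ≤-trans (step n (≤-trans N≤m m≤n)) (decreasing N≤m m≤n)
        ... | inj₂ refl      = ≤-refl

        -- Strong induction on the value of `levelExcess M`: if some later level drops, restart just
        -- after the drop with a strictly smaller value; otherwise `M` itself is stable.
        stabilise : ∀ M → N ≤ M → ∃[ M′ ] (N ≤ M′ × Stable M′)
        stabilise M N≤M = <-rec (λ k → ∀ M → N ≤ M → levelExcess M ≡ k → ∃[ M′ ] (N ≤ M′ × Stable M′)) descend (levelExcess M) M N≤M refl
          where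
          descend : ∀ k → (∀ {j} → j < k → ∀ M → N ≤ M → levelExcess M ≡ j → ∃[ M′ ] (N ≤ M′ × Stable M′)) →
                    ∀ M → N ≤ M → levelExcess M ≡ k → ∃[ M′ ] (N ≤ M′ × Stable M′)
          descend k rec M N≤M refl with em {∃[ n ] (M ≤ n × levelExcess (suc n) < levelExcess n)}
          ... | yes (n , M≤n , drop) = rec (<-≤-trans drop (decreasing N≤M M≤n)) (suc n) (m≤n⇒m≤1+n (≤-trans N≤M M≤n)) refl
          ... | no ¬drop             = M , N≤M , λ n M≤n → ≮⇒≥ (λ drop → ¬drop (n , M≤n , drop))

  -- Counting suffixes by length

  ∑-suffixes-≡ : {X : Set} (q : List X) (c n : ℕ) →
                 ∑[ p ∈ nonemptySuffixes q ] 𝟙 (length p + c ≡ n) ≤ 𝟙 (c < n × n ≤ length q + c)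
  ∑-suffixes-≡ []      c n = z≤n
  ∑-suffixes-≡ (b ∷ q) c n with em {suc (length q) + c ≡ n}
  ... | no _     = ≤-trans (∑-suffixes-≡ q c n) (𝟙-mono (λ (c<n , n≤) → c<n , m≤n⇒m≤1+n n≤))
  ... | yes refl = begin
    1 + (∑[ p ∈ nonemptySuffixes q ] 𝟙 (length p + c ≡ n))  ≤⟨ +-monoʳ-≤ 1 (∑-suffixes-≡ q c n) ⟩
    1 + 𝟙 (c < n × n ≤ length q + c)                        ≡⟨ cong suc (𝟙-false (λ (_ , n≤) → 1+n≰n n≤)) ⟩
    1                                                       ≡⟨ 𝟙-true (s≤s (m≤n+m c (length q)) , ≤-refl) ⟨
    𝟙 (c < n × n ≤ length (b ∷ q) + c)                      ∎
    where open ≤-Reasoning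

  -- Sort the suffixes by `s = length p + c`: their lengths are distinct, so each `s` occurs at most
  -- once, and only in the stated interval. This is how starting positions inside σ(a) become cut
  -- heights.
  ∑-suffixes-< : {X : Set} (q : List X) (c n : ℕ) →
                 ∑[ p ∈ nonemptySuffixes q ] 𝟙 (length p + c < n) ≤ ∑[ s ∈ downFrom n ] 𝟙 (c < s × s ≤ length q + c)
  ∑-suffixes-< q c zero    = ≤-reflexive (∑-0 (nonemptySuffixes q) (λ _ → 𝟙-false (λ ())))
  ∑-suffixes-< q c (suc n) = begin
    ∑[ p ∈ nonemptySuffixes q ] 𝟙 (length p + c < suc n)
      ≤⟨ ∑-mono (nonemptySuffixes q) (λ p → 𝟙-≤ (split p)) ⟩
    ∑[ p ∈ nonemptySuffixes q ] (𝟙 (length p + c ≡ n) + 𝟙 (length p + c < n))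
      ≡⟨ ∑-+ (nonemptySuffixes q) _ _ ⟩
    ∑ (nonemptySuffixes q) (λ p → 𝟙 (length p + c ≡ n)) + ∑ (nonemptySuffixes q) (λ p → 𝟙 (length p + c < n))
      ≤⟨ +-mono-≤ (∑-suffixes-≡ q c n) (∑-suffixes-< q c n) ⟩
    ∑[ s ∈ downFrom (suc n) ] 𝟙 (c < s × s ≤ length q + c) ∎
    where
    open ≤-Reasoning
    split : ∀ p → length p + c < suc n → 1 ≤ 𝟙 (length p + c ≡ n) + 𝟙 (length p + c < n)
    split p (s≤s p+c≤n) with m≤n⇒m<n∨m≡n p+c≤n
    ... | inj₁ <n = ≤-trans (≤-reflexive (sym (𝟙-true <n))) (m≤n+m _ _)
    ... | inj₂ ≡n = ≤-trans (≤-reflexive (sym (𝟙-true ≡n))) (m≤m+n _ _)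

  -- Counting leaves through branchings

  module _ {A B : Alphabet} (σ : Morphism A B) (ne : NonErasing σ) where

    -- Induction along the tree of words in `P`, with `f` bounding the remaining depth. Once `p` has
    -- `n` letters, it determines `u`. Before that, the root contributes one leaf plus its excess,
    -- and each child subtree is handled recursively.
    ∑-Reach-≤ : ∀ n f p (P : Word A → Set) → PrefixClosed A P → n ≤ length p + f →
                ∑[ u ∈ wordsOfLength B n ] 𝟙 (Reach σ p P u)
                  ≤ 1 + (∑[ v ∈ wordsBelow A f ] (𝟙 (length p + imageLength σ v < n) * excess A P v))
    ∑-Reach-≤ n f p P closed n≤ with ≤-<-connex n (length p)
    ... | inj₁ n≤p = ≤-trans (∑𝟙≤1 (words-unique B n) same) (s≤s z≤n)
      where
      initial : ∀ {u} → u ∈ wordsOfLength B n → Reach σ p P u → u ≡ take n p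
      initial {u} u∈ (_ , _ , _ , eq) = subst (λ k → u ≡ take k p) (length-∈-words B n u∈)
        (take-++ u eq (subst (_≤ length p) (sym (length-∈-words B n u∈)) n≤p))

      same : ∀ {u v} → u ∈ wordsOfLength B n → v ∈ wordsOfLength B n → Reach σ p P u → Reach σ p P v → u ≡ v
      same u∈ v∈ ru rv = trans (initial u∈ ru) (sym (initial v∈ rv))
    ∑-Reach-≤ n zero    p P closed n≤ | inj₂ p<n = contradiction (subst (n ≤_) (+-identityʳ (length p)) n≤) (<⇒≱ p<n)
    ∑-Reach-≤ n (suc f) p P closed n≤ | inj₂ p<n = begin
      ∑[ u ∈ wordsOfLength B n ] 𝟙 (Reach σ p P u)
        ≤⟨ ∑-mono-∈ (wordsOfLength B n) (λ u∈ → 𝟙-≤ (branch u∈)) ⟩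
      ∑[ u ∈ wordsOfLength B n ] ∑[ b ∈ letters A ] 𝟙 (Next b u)
        ≡⟨ ∑-swap (wordsOfLength B n) (letters A) _ ⟩
      ∑[ b ∈ letters A ] ∑[ u ∈ wordsOfLength B n ] 𝟙 (Next b u)
        ≤⟨ ∑-mono (letters A) next-≤ ⟩
      ∑[ b ∈ letters A ] (𝟙 (P [ b ]) + (∑[ v ∈ wordsBelow A f ] weight (b ∷ v)))
        ≡⟨ ∑-+ (letters A) _ _ ⟩
      degree A P [] + (∑[ b ∈ letters A ] ∑[ v ∈ wordsBelow A f ] weight (b ∷ v))
        -- Only an inequality, because `P` may have no one-letter word, and then the degree is 0.
        ≤⟨ +-monoˡ-≤ _ (m≤n+m∸n (degree A P []) 1) ⟩
      1 + excess A P [] + (∑[ b ∈ letters A ] ∑[ v ∈ wordsBelow A f ] weight (b ∷ v))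
        ≡⟨ cong (λ k → 1 + k + (∑[ b ∈ letters A ] ∑[ v ∈ wordsBelow A f ] weight (b ∷ v))) weight-[] ⟨
      1 + weight [] + (∑[ b ∈ letters A ] ∑[ v ∈ wordsBelow A f ] weight (b ∷ v))
        ≡⟨ cong (λ k → 1 + weight [] + k) (∑-cartesianProductWith _∷_ (letters A) (wordsBelow A f) weight) ⟨
      1 + ∑ (wordsBelow A (suc f)) weight ∎
      where
      open ≤-Reasoning

      weight : Word A → ℕ
      weight v = 𝟙 (length p + imageLength σ v < n) * excess A P v

      Next : Letter A → Word B → Set
      Next b = Reach σ (p ++ ⟦ σ ⟧ [ b ]) (P ∘ (b ∷_))

      weight-[] : weight [] ≡ excess A P []
      weight-[] = trans (cong (_* excess A P []) (𝟙-true (subst (_< n) (sym p+0) p<n))) (*-identityˡ _)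
        where
        p+0 : length p + imageLength σ [] ≡ length p
        p+0 = trans (cong (λ w → length p + length w) (⟦⟧-[] σ)) (+-identityʳ _)

      branch : ∀ {u} → u ∈ wordsOfLength B n → Reach σ p P u → 1 ≤ ∑[ b ∈ letters A ] 𝟙 (Next b u)
      branch {u} u∈ ([] , q , _ , eq) = contradiction n≤p (<⇒≱ p<n)
        where
        n≤p : n ≤ length p
        n≤p = begin
          n                               ≡⟨ length-∈-words B n u∈ ⟨
          length u                        ≤⟨ m≤m+n _ _ ⟩
          length u + length q             ≡⟨ length-++ u ⟨
          length (u ++ q)                 ≡⟨ cong length eq ⟩
          length (p ++ ⟦ σ ⟧ [])          ≡⟨ cong (λ w → length (p ++ w)) (⟦⟧-[] σ) ⟩
          length (p ++ [])                ≡⟨ cong length (++-identityʳ p) ⟩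
          length p                        ∎
      branch {u} u∈ (b ∷ z , q , z∈ , eq) =
        ≤-trans (≤-reflexive (sym (𝟙-true next))) (term≤∑ (λ b → 𝟙 (Next b u)) (∈-letters A b))
        where
        next : Next b u
        next = z , q , z∈ , trans eq (trans (cong (p ++_) (Morphism.homo σ [ b ] z)) (sym (++-assoc p _ _)))

      length-next : ∀ b k → length (p ++ ⟦ σ ⟧ [ b ]) + k ≡ length p + (imageLength σ [ b ] + k)
      length-next b k = trans (cong (_+ k) (length-++ p)) (+-assoc (length p) _ k)

      next-≤ : ∀ b → ∑[ u ∈ wordsOfLength B n ] 𝟙 (Next b u) ≤ 𝟙 (P [ b ]) + (∑[ v ∈ wordsBelow A f ] weight (b ∷ v))
      next-≤ b with em {P [ b ]}
      ... | no ¬Pb = ≤-trans (≤-reflexive (∑-0 (wordsOfLength B n) (λ _ → 𝟙-false (λ (z , _ , z∈ , _) → ¬Pb (closed [ b ] z z∈))))) z≤n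
      ... | yes Pb = begin
        ∑[ u ∈ wordsOfLength B n ] 𝟙 (Next b u)
          ≤⟨ ∑-Reach-≤ n f (p ++ ⟦ σ ⟧ [ b ]) (P ∘ (b ∷_)) (λ v w → closed (b ∷ v) w) n≤′ ⟩
        1 + (∑[ v ∈ wordsBelow A f ] (𝟙 (length (p ++ ⟦ σ ⟧ [ b ]) + imageLength σ v < n) * excess A P (b ∷ v)))
          ≡⟨ cong suc (∑-cong (wordsBelow A f) (λ v → cong (λ k → 𝟙 (k < n) * excess A P (b ∷ v))
               (trans (length-next b _) (cong (λ k → length p + k) (sym (imageLength-∷ σ b v)))))) ⟩
        1 + (∑[ v ∈ wordsBelow A f ] weight (b ∷ v)) ∎
        where
        n≤′ : n ≤ length (p ++ ⟦ σ ⟧ [ b ]) + f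
        -- Since σ(b) is nonempty, lengthening `p` by it pays for lowering `f` by one.
        n≤′ = ≤-trans n≤ (≤-trans (+-monoʳ-≤ (length p) (+-monoˡ-≤ f (length≤length-image σ ne [ b ]))) (≤-reflexive (sym (length-next b f))))

    -- Excess on cuts and the complexity of the image

    module _ (x : BiInfiniteWord (Letter A)) where

      private
        r : Word A → ℕ
        r = excess A (𝓛 x)

      onCut : ℕ → Letter A → Word A → ℕ
      onCut s a v = 𝟙 (imageLength σ v < s × s ≤ imageLength σ (a ∷ v))

      cutExcess : ℕ → Word A → ℕ
      cutExcess s v = ∑[ a ∈ letters A ] (onCut s a v * r (a ∷ v))

      -- This is Σ_a |σ(a)|, the number of places inside a letter image where a factor can start;
      -- each gives one initial leaf.
      offsets : ℕ
      offsets = ∑[ a ∈ letters A ] ∑[ p ∈ nonemptySuffixes (⟦ σ ⟧ [ a ]) ] 1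

      -- Sum the leaf count over all starting suffixes `p` of all σ(a). A branching at `a ∷ v`
      -- counts once for each `p` with |p| + |σ(v)| < n, that is, at most once for each `s < n`
      -- whose cut contains `a ∷ v`.
      complexity-image-≤ : ∀ n → complexity em B (image σ ne x) n
                               ≤ offsets + (∑[ s ∈ downFrom n ] ∑ (wordsBelow A s) (cutExcess s))
      complexity-image-≤ n = begin
        complexity em B (image σ ne x) n
          ≡⟨ card≡∑𝟙 (wordsOfLength B n) (𝓛[_] (image σ ne x) n) ⟩
        ∑[ u ∈ W ] 𝟙 (𝓛[_] (image σ ne x) n u)
          ≤⟨ ∑-mono W (λ u → 𝟙-≤ (λ (u∈ , _) → reach u u∈)) ⟩
        ∑[ u ∈ W ] ∑[ a ∈ letters A ] ∑[ p ∈ suffixes a ] 𝟙 (Reach σ p (𝓛 x ∘ (a ∷_)) u)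
          ≡⟨ trans (∑-swap W (letters A) _) (∑-cong (letters A) (λ a → ∑-swap W (suffixes a) _)) ⟩
        ∑[ a ∈ letters A ] ∑[ p ∈ suffixes a ] ∑[ u ∈ W ] 𝟙 (Reach σ p (𝓛 x ∘ (a ∷_)) u)
          ≤⟨ ∑-mono (letters A) (λ a → ∑-mono (suffixes a) (λ p →
               ∑-Reach-≤ n n p (𝓛 x ∘ (a ∷_)) (λ v w → 𝓛-prefix x (a ∷ v) w) (m≤n+m n (length p)))) ⟩
        ∑[ a ∈ letters A ] ∑[ p ∈ suffixes a ] (1 + (∑[ v ∈ wordsBelow A n ] (𝟙 (length p + imageLength σ v < n) * r (a ∷ v))))
          ≡⟨ trans (∑-cong (letters A) (λ a → ∑-+ (suffixes a) _ _)) (∑-+ (letters A) _ _) ⟩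
        offsets + (∑[ a ∈ letters A ] ∑[ p ∈ suffixes a ] ∑[ v ∈ wordsBelow A n ] (𝟙 (length p + imageLength σ v < n) * r (a ∷ v)))
          ≤⟨ +-monoʳ-≤ offsets (∑-mono (letters A) regroup) ⟩
        offsets + (∑[ a ∈ letters A ] ∑[ s ∈ downFrom n ] ∑[ v ∈ wordsBelow A n ] (onCut s a v * r (a ∷ v)))
          ≡⟨ cong (λ k → offsets + k) (trans (∑-swap (letters A) (downFrom n) _)
               (∑-cong (downFrom n) (λ s → ∑-swap (letters A) (wordsBelow A n) _))) ⟩
        offsets + (∑[ s ∈ downFrom n ] ∑ (wordsBelow A n) (cutExcess s))
          -- The depth `n` becomes `s`: if `a ∷ v` is on the cut, then |v| ≤ |σ(v)| < s.
          ≤⟨ +-monoʳ-≤ offsets (∑-mono (downFrom n) (λ s → ∑-wordsBelow-vanishing A (vanish s) n)) ⟩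
        offsets + (∑[ s ∈ downFrom n ] ∑ (wordsBelow A s) (cutExcess s)) ∎
        where
        open ≤-Reasoning

        W : List (Word B)
        W = wordsOfLength B n

        suffixes : Letter A → List (Word B)
        suffixes a = nonemptySuffixes (⟦ σ ⟧ [ a ])

        reach : ∀ u → 𝓛 (image σ ne x) u → 1 ≤ ∑[ a ∈ letters A ] ∑[ p ∈ suffixes a ] 𝟙 (Reach σ p (𝓛 x ∘ (a ∷_)) u)
        reach u u∈ = let a , p , p∈ , ru = image-reach σ ne x u∈ in begin
          1                                                                          ≡⟨ 𝟙-true ru ⟨
          𝟙 (Reach σ p (𝓛 x ∘ (a ∷_)) u)                                             ≤⟨ term≤∑ (λ p → 𝟙 (Reach σ p (𝓛 x ∘ (a ∷_)) u)) p∈ ⟩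
          ∑[ p ∈ suffixes a ] 𝟙 (Reach σ p (𝓛 x ∘ (a ∷_)) u)                         ≤⟨ term≤∑ (λ a → ∑[ p ∈ suffixes a ] 𝟙 (Reach σ p (𝓛 x ∘ (a ∷_)) u)) (∈-letters A a) ⟩
          ∑[ a ∈ letters A ] ∑[ p ∈ suffixes a ] 𝟙 (Reach σ p (𝓛 x ∘ (a ∷_)) u)      ∎

        regroup : ∀ a → ∑[ p ∈ suffixes a ] ∑[ v ∈ wordsBelow A n ] (𝟙 (length p + imageLength σ v < n) * r (a ∷ v))
                        ≤ ∑[ s ∈ downFrom n ] ∑[ v ∈ wordsBelow A n ] (onCut s a v * r (a ∷ v))
        regroup a = begin
          ∑[ p ∈ suffixes a ] ∑[ v ∈ wordsBelow A n ] (𝟙 (length p + imageLength σ v < n) * r (a ∷ v))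
            ≡⟨ ∑-swap (suffixes a) (wordsBelow A n) _ ⟩
          ∑[ v ∈ wordsBelow A n ] ∑[ p ∈ suffixes a ] (𝟙 (length p + imageLength σ v < n) * r (a ∷ v))
            ≡⟨ ∑-cong (wordsBelow A n) (λ v → ∑-*ʳ (suffixes a) _ (r (a ∷ v))) ⟩
          ∑[ v ∈ wordsBelow A n ] ((∑[ p ∈ suffixes a ] 𝟙 (length p + imageLength σ v < n)) * r (a ∷ v))
            ≤⟨ ∑-mono (wordsBelow A n) (λ v → *-monoˡ-≤ (r (a ∷ v)) (∑-suffixes-< (⟦ σ ⟧ [ a ]) (imageLength σ v) n)) ⟩
          ∑[ v ∈ wordsBelow A n ] ((∑[ s ∈ downFrom n ] 𝟙 (imageLength σ v < s × s ≤ imageLength σ [ a ] + imageLength σ v)) * r (a ∷ v))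
            ≡⟨ ∑-cong (wordsBelow A n) (λ v → cong (λ k → (∑[ s ∈ downFrom n ] 𝟙 (imageLength σ v < s × s ≤ k)) * r (a ∷ v)) (imageLength-∷ σ a v)) ⟨
          ∑[ v ∈ wordsBelow A n ] ((∑[ s ∈ downFrom n ] onCut s a v) * r (a ∷ v))
            ≡⟨ ∑-cong (wordsBelow A n) (λ v → ∑-*ʳ (downFrom n) _ (r (a ∷ v))) ⟨
          ∑[ v ∈ wordsBelow A n ] ∑[ s ∈ downFrom n ] (onCut s a v * r (a ∷ v))
            ≡⟨ ∑-swap (wordsBelow A n) (downFrom n) _ ⟩
          ∑[ s ∈ downFrom n ] ∑[ v ∈ wordsBelow A n ] (onCut s a v * r (a ∷ v)) ∎

        vanish : ∀ s {v} → s ≤ length v → cutExcess s v ≡ 0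
        vanish s {v} s≤v = ∑-0 (letters A) (λ {a} _ → cong (_* r (a ∷ v))
          (𝟙-false (λ (v<s , _) → <⇒≱ v<s (≤-trans s≤v (length≤length-image σ ne v)))))

      -- Push the excess of the cut down to level `M`, one level at a time. A word past the cut
      -- hands its excess to its children by `grow`, and none of them is on the cut; for a word not
      -- yet past it, the children that reach `s` are themselves on the cut.
      ∑cutExcess-≤ : ∀ s → (∀ v → s ≤ imageLength σ v → r v ≤ childExcess A x v) →
                     ∀ M → ∑ (wordsBelow A M) (cutExcess s) ≤ ∑[ w ∈ wordsOfLength A M ] (𝟙 (s ≤ imageLength σ w) * r w)
      ∑cutExcess-≤ s grow zero    = z≤n
      ∑cutExcess-≤ s grow (suc M) = begin
        ∑ (wordsBelow A (suc M)) (cutExcess s)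
          ≡⟨ ∑-wordsBelow-suc A M (cutExcess s) ⟩
        ∑ (wordsBelow A M) (cutExcess s) + ∑ (wordsOfLength A M) (cutExcess s)
          ≤⟨ +-monoˡ-≤ _ (∑cutExcess-≤ s grow M) ⟩
        ∑ (wordsOfLength A M) (λ v → 𝟙 (s ≤ imageLength σ v) * r v) + ∑ (wordsOfLength A M) (cutExcess s)
          ≡⟨ ∑-+ (wordsOfLength A M) _ _ ⟨
        ∑[ v ∈ wordsOfLength A M ] (𝟙 (s ≤ imageLength σ v) * r v + cutExcess s v)
          ≤⟨ ∑-mono (wordsOfLength A M) step ⟩
        ∑[ v ∈ wordsOfLength A M ] ∑[ a ∈ letters A ] (𝟙 (s ≤ imageLength σ (a ∷ v)) * r (a ∷ v))
          ≡⟨ ∑-words-∷ A M _ ⟨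
        ∑[ w ∈ wordsOfLength A (suc M) ] (𝟙 (s ≤ imageLength σ w) * r w) ∎
        where
        open ≤-Reasoning
        step : ∀ v → 𝟙 (s ≤ imageLength σ v) * r v + cutExcess s v ≤ ∑[ a ∈ letters A ] (𝟙 (s ≤ imageLength σ (a ∷ v)) * r (a ∷ v))
        step v with em {s ≤ imageLength σ v}
        ... | no _   = ∑-mono (letters A) (λ a → *-monoˡ-≤ (r (a ∷ v)) (𝟙-mono proj₂))
        ... | yes s≤ = begin
          1 * r v + cutExcess s v
            ≡⟨ cong₂ _+_ (*-identityˡ (r v)) (∑-0 (letters A) (λ {a} _ → cong (_* r (a ∷ v)) (𝟙-false (λ (v<s , _) → <⇒≱ v<s s≤)))) ⟩
          r v + 0
            ≡⟨ +-identityʳ (r v) ⟩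
          r v
            ≤⟨ grow v s≤ ⟩
          childExcess A x v
            ≡⟨ ∑-cong (letters A) (λ a → trans (cong (_* r (a ∷ v)) (𝟙-true (longer a))) (*-identityˡ _)) ⟨
          ∑[ a ∈ letters A ] (𝟙 (s ≤ imageLength σ (a ∷ v)) * r (a ∷ v)) ∎
          where
          longer : ∀ a → s ≤ imageLength σ (a ∷ v)
          longer a = ≤-trans s≤ (≤-trans (m≤n+m _ (imageLength σ [ a ])) (≤-reflexive (sym (imageLength-∷ σ a v))))

      expanding⇒complexity-≤ : EventuallyExpanding A x →
                                   ∃[ C ] (∀ n → complexity em B (image σ ne x) n ≤ C + complexity em A x n)
      expanding⇒complexity-≤ (N , expands) = offsets + ∑ (downFrom s₀) T , λ n → begin
        complexity em B (image σ ne x) n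
          ≤⟨ complexity-image-≤ n ⟩
        offsets + ∑ (downFrom n) T
          ≤⟨ +-monoʳ-≤ offsets (∑-downFrom-eventually-≤ T (levelExcess A x) s₀ T≤level n) ⟩
        offsets + (∑ (downFrom s₀) T + ∑ (downFrom n) (levelExcess A x))
          ≤⟨ +-monoʳ-≤ offsets (+-monoʳ-≤ (∑ (downFrom s₀) T) (∑levelExcess≤complexity A x n)) ⟩
        offsets + (∑ (downFrom s₀) T + complexity em A x n)
          ≡⟨ +-assoc offsets _ _ ⟨
        offsets + ∑ (downFrom s₀) T + complexity em A x n ∎
        where
        open ≤-Reasoning

        T : ℕ → ℕ
        T s = ∑ (wordsBelow A s) (cutExcess s)

        L s₀ : ℕ
        L  = ∑[ a ∈ letters A ] imageLength σ [ a ]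
        -- A word shorter than `N` has an image of length at most `N * L`, so image length `s₀`
        -- forces length at least `N`.
        s₀ = suc (N * L)

        grow : ∀ {s} → s₀ ≤ s → ∀ v → s ≤ imageLength σ v → r v ≤ childExcess A x v
        grow s₀≤s v s≤ with ≤-<-connex N (length v)
        ... | inj₁ N≤v = expands v N≤v
        ... | inj₂ v<N = contradiction (≤-trans (≤-trans s₀≤s s≤) (≤-trans (imageLength-≤ σ v) (*-monoˡ-≤ L (<⇒≤ v<N)))) 1+n≰n

        T≤level : ∀ {s} → s₀ ≤ s → T s ≤ levelExcess A x s
        -- Taking `M = s` accounts for all of `T s`; the indicator on level `s` is then bounded by
        -- 1.
        T≤level {s} s₀≤s = ≤-trans (∑cutExcess-≤ s (grow s₀≤s) s)
          (∑-mono (wordsOfLength A s) (λ w → ≤-trans (*-monoˡ-≤ (r w) (𝟙-≤ (λ _ → ≤-refl))) (≤-reflexive (*-identityˡ (r w)))))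

-- The complexity bound under either hypothesis

theorem13 : (em : ExcludedMiddle 0ℓ) (A B : Alphabet) (x : BiInfiniteWord (Letter A)) →
            EventuallyWeakOrNeutral em A x ⊎ EventuallyStrongOrNeutral em A x →
            (σ : Morphism A B) (ne : NonErasing σ) →
            ∃[ C ] ((n : ℕ) → ℤ.+ complexity em B (image σ ne x) n ℤ.≤ C ℤ.+ ℤ.+ complexity em A x n)
theorem13 em A B x weakOrStrong σ ne =
  let C , bound = expanding⇒complexity-≤ em σ ne x (expanding weakOrStrong)
  in ℤ.+ C , λ n → +≤+ (bound n)
  where
  expanding : EventuallyWeakOrNeutral em A x ⊎ EventuallyStrongOrNeutral em A x → EventuallyExpanding em A x
  expanding (inj₁ weak)   = weak⇒expanding em A x weak
  expanding (inj₂ strong) = strong⇒expanding em A x strong
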